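{- Let $C\ge1$ be a constant and let $s:\mathbb N\to\mathbb N$ satisfy $s(d)=o(d^2)$. Then for all sufficiently large $d$ there is no (possibly randomized) algorithm which, from $s(d)$ samples whose points $x_i$ are drawn independently and uniformly from $[-1,1]$, achieves a $C$-approximation in $\ell_\infty$ norm with failure probability at most $1/4$. That is, for every algorithm mapping samples $(x_i,y_i)_{i\le s(d)}$ to a function $\widehat p:[-1,1]\to\mathbb R$ there exist a real polynomial $p$ of degree at most $d$, a noise level $\sigma>0$, and an adversary choosing values $y_i$ with $|y_i-p(x_i)|\le\sigma$ for all $i$, such that $\Pr\left[\|\widehat p-p\|_\infty>C\sigma\right]>\tfrac14$.
   Context: $\|f\|_\infty=\sup_{x\in[-1,1]}|f(x)|$. Setting: polynomial regression, where an unknown real polynomial $p$ of degree at most $d$ is observed through samples $(x_i,y_i)$; the points $x_i$ are random, and an adversary picks the $y_i$ subject to $|y_i-p(x_i)|\le\sigma$ (no outliers are needed here). The algorithm may know $d$, $C$, $\sigma$ and $s(d)$. The probability is over the points $x_i$ and any randomness of the algorithm and the adversary. -}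

module Defs where

open import Level using (Level; 0ℓ; _⊔_) renaming (suc to lsuc)
open import Algebra.Structures using (IsCommutativeRing)
open import Data.Fin using (Fin)
open import Data.Nat using (ℕ; zero; suc)
import Data.Nat as ℕ
open import Data.Product using (Σ; ∃; ∃-syntax; _×_; _,_; proj₁; uncurry)
open import Data.Sum using ([_,_]′)
open import Data.Vec using (Vec; []; _∷_; lookup; zip; foldr′)
open import Data.Vec.Relation.Unary.All using (All)
open import Function using (const)
open import Relation.Binary.Core using (Rel)
open import Relation.Binary.PropositionalEquality using (_≡_; _≢_)
open import Relation.Binary.Structures using (IsTotalOrder)
import Relation.Binary.Construct.NonStrictToStrict as ToStrict
open import Relation.Nullary using (¬_)
open import Relation.Unary
  using (Pred; U; ∁; ⋃; _∈_; _⊆_; _≐_; _∩_; _⟨×⟩_; _⊢_)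

-- The real numbers are given axiomatically, as a Dedekind-complete ordered
-- field; classically this determines them up to unique isomorphism.
-- The value of 0# ⁻¹ is left unspecified.
record CompleteOrderedField : Set₁ where
  infixl 6 _+_
  infixl 7 _*_
  infix  8 -_
  infix  9 _⁻¹
  infix  4 _≤_
  field
    ℝ                 : Set
    _+_ _*_           : ℝ → ℝ → ℝ
    -_ _⁻¹            : ℝ → ℝ
    0# 1#             : ℝ
    _≤_               : Rel ℝ 0ℓ
    isCommutativeRing : IsCommutativeRing _≡_ _+_ _*_ -_ 0# 1#
    0≢1               : 0# ≢ 1#
    *-inverse         : ∀ x → x ≢ 0# → x * x ⁻¹ ≡ 1#
    isTotalOrder      : IsTotalOrder _≡_ _≤_
    +-monoˡ-≤         : ∀ x y z → x ≤ y → x + z ≤ y + z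
    *-nonNeg          : ∀ x y → 0# ≤ x → 0# ≤ y → 0# ≤ x * y

  UpperBound : Pred ℝ 0ℓ → Pred ℝ 0ℓ
  UpperBound S b = ∀ x → x ∈ S → x ≤ b

  LeastUpperBound : Pred ℝ 0ℓ → Pred ℝ 0ℓ
  LeastUpperBound S b = UpperBound S b × (∀ c → UpperBound S c → b ≤ c)

  field
    complete : ∀ (S : Pred ℝ 0ℓ) → ∃ S → ∃ (UpperBound S) → ∃ (LeastUpperBound S)

  open ToStrict _≡_ _≤_ public using (_<_)

-- The σ-algebra generated by a family of sets.
data σ⟨_⟩ {a : Level} {A : Set} {I : Set a} (gen : I → Pred A 0ℓ)
       : Pred A 0ℓ → Set (lsuc 0ℓ ⊔ a) where
  generator  : ∀ i → σ⟨ gen ⟩ (gen i)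
  full       : σ⟨ gen ⟩ U
  complement : ∀ {S} → σ⟨ gen ⟩ S → σ⟨ gen ⟩ (∁ S)
  union      : ∀ {S : ℕ → Pred A 0ℓ} → (∀ n → σ⟨ gen ⟩ (S n)) → σ⟨ gen ⟩ (⋃ ℕ S)
  resp-≐     : ∀ {S T} → S ≐ T → σ⟨ gen ⟩ S → σ⟨ gen ⟩ T

record MeasurableSpace : Set₂ where
  field
    Carrier      : Set
    Measurable   : Pred (Pred Carrier 0ℓ) (lsuc 0ℓ)
    U-measurable : Measurable U
    ∁-measurable : ∀ {S} → Measurable S → Measurable (∁ S)
    ⋃-measurable : ∀ {S : ℕ → Pred Carrier 0ℓ} →
                   (∀ n → Measurable (S n)) → Measurable (⋃ ℕ S)
    measurable-≐ : ∀ {S T} → S ≐ T → Measurable S → Measurable T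

  MeasurableSet : Set₁
  MeasurableSet = ∃ Measurable

open MeasurableSpace public using (Carrier; Measurable; MeasurableSet)

generatedBy : {A : Set} {I : Set₁} → (I → Pred A 0ℓ) → MeasurableSpace
generatedBy {A} gen = record
  { Carrier      = A
  ; Measurable   = σ⟨ gen ⟩
  ; U-measurable = full
  ; ∁-measurable = complement
  ; ⋃-measurable = union
  ; measurable-≐ = resp-≐
  }

MeasurableMap : (M N : MeasurableSpace) → (Carrier M → Carrier N) → Set₁
MeasurableMap M N f = ∀ {S} → Measurable N S → Measurable M (f ⊢ S)

infixr 5 _⊗_
_⊗_ : MeasurableSpace → MeasurableSpace → MeasurableSpace
M ⊗ N = generatedBy {I = MeasurableSet M × MeasurableSet N}
  λ where ((S , _) , (T , _)) → S ⟨×⟩ T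

Power : MeasurableSpace → ℕ → MeasurableSpace
Power M n = generatedBy {A = Vec (Carrier M) n} {I = Fin n × MeasurableSet M}
  λ where (i , (S , _)) xs → lookup xs i ∈ S

module Regression (𝓡 : CompleteOrderedField) where
  open CompleteOrderedField 𝓡 public

  infixl 6 _-_
  infixl 7 _/_

  _-_ : ℝ → ℝ → ℝ
  x - y = x + (- y)

  _/_ : ℝ → ℝ → ℝ
  x / y = x * y ⁻¹

  fromℕ : ℕ → ℝ
  fromℕ zero    = 0#
  fromℕ (suc n) = 1# + fromℕ n

  ∣_∣ : ℝ → ℝ
  ∣ x ∣ = [ const x , const (- x) ]′ (IsTotalOrder.total isTotalOrder 0# x)

  ∑ : ℕ → (ℕ → ℝ) → ℝ
  ∑ zero    f = 0#
  ∑ (suc n) f = ∑ n f + f n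

  ∏ : ∀ n → (Fin n → ℝ) → ℝ
  ∏ zero    f = 1#
  ∏ (suc n) f = f Fin.zero * ∏ n (λ i → f (Fin.suc i))

  _ConvergesTo_ : (ℕ → ℝ) → ℝ → Set
  u ConvergesTo l =
    ∀ ε → 0# < ε → ∃[ N ] ∀ n → N ℕ.≤ n → ∣ u n - l ∣ ≤ ε

  _∈o_ : (ℕ → ℕ) → (ℕ → ℕ) → Set
  f ∈o g = ∀ ε → 0# < ε →
    ∃[ N ] ∀ n → N ℕ.≤ n → fromℕ (f n) ≤ ε * fromℕ (g n)

  [-1,1] : Pred ℝ 0ℓ
  [-1,1] x = (- 1#) ≤ x × x ≤ 1#

  Interval : Set
  Interval = ∃ [-1,1]

  -- A polynomial of degree at most d, as its coefficients, constant term first.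
  Poly≤ : ℕ → Set
  Poly≤ d = Vec ℝ (suc d)

  ⟦_⟧ : ∀ {d} → Poly≤ d → ℝ → ℝ
  ⟦ p ⟧ x = foldr′ (λ a acc → a + x * acc) 0# p

  -- Sup-norms lie in [0,∞], since a function on [-1,1] may be unbounded.
  data ℝ∞ : Set where
    fin : ℝ → ℝ∞
    ∞   : ℝ∞

  data _<∞_ (t : ℝ) : ℝ∞ → Set where
    <-fin : ∀ {v} → t < v → t <∞ fin v
    <-∞   : t <∞ ∞

  Supremum : Pred ℝ 0ℓ → ℝ∞ → Set
  Supremum S (fin b) = LeastUpperBound S b
  Supremum S ∞       = ¬ ∃ (UpperBound S)

  SupNorm : (Interval → ℝ) → ℝ∞ → Set
  SupNorm f = Supremum (λ y → ∃[ x ] y ≡ ∣ f x ∣)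

  ‖_‖∞>_ : (Interval → ℝ) → ℝ → Set
  ‖ f ‖∞> t = ∃[ v ] SupNorm f v × t <∞ v

  Borel : MeasurableSpace
  Borel = generatedBy {I = Level.Lift (lsuc 0ℓ) ℝ} λ t x → x ≤ Level.lower t

  -- prob is total for convenience; it is constrained, and meaningful, only on
  -- measurable sets.
  record ProbabilitySpace : Set₂ where
    field
      space    : MeasurableSpace
    open MeasurableSpace space public using () renaming (Carrier to Ω)
    field
      prob      : Pred Ω 0ℓ → ℝ
      prob-resp : ∀ {S T} → Measurable space S → S ≐ T → prob S ≡ prob T
      nonNeg    : ∀ {S} → Measurable space S → 0# ≤ prob S
      total     : prob U ≡ 1#
      additive  : ∀ (S : ℕ → Pred Ω 0ℓ) → (∀ n → Measurable space (S n)) →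
                  (∀ m n → m ≢ n → ∀ ω → ¬ (ω ∈ S m × ω ∈ S n)) →
                  (λ n → ∑ n (λ k → prob (S k))) ConvergesTo prob (⋃ ℕ S)

    -- "Pr[E] > c" for the outer probability of E.  For measurable E it is
    -- c < prob E; in general it says that no measurable set of probability
    -- at most c contains E.  This gives the failure event a meaning for an
    -- arbitrary estimator, with no measurability condition on its output.
    Pr[_]>_ : Pred Ω 0ℓ → ℝ → Set₁
    Pr[ E ]> c = ∀ {S} → Measurable space S → E ⊆ S → c < prob S

  -- The sources of randomness: n points, independent and uniform on [-1,1],
  -- a seed for the algorithm and a seed for the adversary, all independent.
  record Experiment (n : ℕ) : Set₂ where
    field
      probabilitySpace : ProbabilitySpace
    open ProbabilitySpace probabilitySpace public
    field
      algSeed advSeed     : MeasurableSpace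
      points              : Ω → Vec ℝ n
      algCoins            : Ω → Carrier algSeed
      advCoins            : Ω → Carrier advSeed
      points-measurable   : MeasurableMap space (Power Borel n) points
      algCoins-measurable : MeasurableMap space algSeed algCoins
      advCoins-measurable : MeasurableMap space advSeed advCoins
      points∈[-1,1]       : ∀ ω → All [-1,1] (points ω)

    point : Fin n → Ω → ℝ
    point i ω = lookup (points ω) i

    field
      uniform     : ∀ i a b → - 1# ≤ a → a ≤ b → b ≤ 1# →
                    prob (λ ω → a ≤ point i ω × point i ω ≤ b) ≡ (b - a) / fromℕ 2
      -- Taking some of the sets to be the whole space gives the product
      -- formula for every subfamily.
      independent : ∀ (B : Fin n → MeasurableSet Borel)
                      ((S , _) : MeasurableSet algSeed)
                      ((T , _) : MeasurableSet advSeed) →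
        prob ((λ ω → ∀ i → point i ω ∈ proj₁ (B i)) ∩ (algCoins ⊢ S) ∩ (advCoins ⊢ T))
        ≡ ∏ n (λ i → prob (point i ⊢ proj₁ (B i)))
          * (prob (algCoins ⊢ S) * prob (advCoins ⊢ T))

  module _ {n : ℕ} (𝓔 : Experiment n) where
    open Experiment 𝓔

    -- The first argument is the noise level, which the algorithm may use.
    Algorithm : Set
    Algorithm = ℝ → Carrier algSeed → Vec (ℝ × ℝ) n → Interval → ℝ

    -- The adversary sees all the points and its own coins, but not those of
    -- the algorithm.
    record Adversary {d : ℕ} (p : Poly≤ d) (σ : ℝ) : Set₁ where
      field
        values     : Carrier advSeed → Vec ℝ n → Vec ℝ n
        measurable : MeasurableMap (advSeed ⊗ Power Borel n) (Power Borel n)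
                       (uncurry values)
        bounded    : ∀ v xs → All [-1,1] xs → ∀ i →
                     ∣ lookup (values v xs) i - ⟦ p ⟧ (lookup xs i) ∣ ≤ σ

    estimate : ∀ {d} {p : Poly≤ d} {σ} →
               Algorithm → Adversary p σ → Ω → Interval → ℝ
    estimate {σ = σ} alg adv ω =
      alg σ (algCoins ω)
        (zip (points ω) (Adversary.values adv (advCoins ω) (points ω)))

    -- The event ‖ p̂ - p ‖∞ > C σ.
    Failure : ∀ {d} {p : Poly≤ d} {σ} →
              ℝ → Algorithm → Adversary p σ → Pred Ω 0ℓ
    Failure {p = p} {σ} C alg adv ω =
      ‖ (λ x → estimate alg adv ω x - ⟦ p ⟧ (proj₁ x)) ‖∞> (C * σ)

{-# OPTIONS --safe #-}
module Submission where

-- Put δ = 2C/d² and q(x) = T_d(x + δ), where T_d is the Chebyshev polynomial.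
-- Then |q| ≤ 1 on [-1, 1 - δ], whereas q(1) = T_d(1 + δ) ≥ 1 + d²δ > 2C.  As
-- long as no sample point falls into (1 - δ, 1], the answers y = 0 are
-- compatible at noise level 1 both with p = q and with p = 0, and no estimate
-- can be within C of both q(1) and 0.  The tail is hit with probability at most
-- s(d) δ / 2 ≤ 1/4 for large d, so if the estimator failed with probability at
-- most 1/4 against each of q and 0, three events of probability at most 1/4
-- would cover the sample space.

open import Defs
open import Algebra.Bundles using (CommutativeRing)
open import Algebra.Solver.Ring.AlmostCommutativeRing using (fromCommutativeRing; _-Raw-AlmostCommutative⟶_)
import Algebra.Properties.Ring as RingProperties
import Algebra.Solver.Ring as RingSolver
open import Algebra.Structures using (IsCommutativeRing)
open import Axiom.ExcludedMiddle using (ExcludedMiddle)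
open import Data.Empty using (⊥)
open import Data.Fin using (Fin)
import Data.Maybe as Maybe
open import Data.Integer as ℤ using (ℤ; +_; -[1+_])
import Data.Integer.Properties as ℤ
open import Data.Nat as ℕ using (ℕ; zero; suc; _^_) renaming (_≤_ to _≤ℕ_)
import Data.Nat.Properties as ℕ
open import Data.Product using (∃-syntax; Σ-syntax; _×_; _,_; proj₁; proj₂)
open import Data.Sign as Sign using (Sign)
open import Data.Sum as Sum using (_⊎_; inj₁; inj₂; [_,_]′)
open import Data.Unit using (tt)
open import Data.Vec using (Vec; []; _∷_; _∷ʳ_; lookup; map; zip; zipWith; replicate; foldr′)
open import Data.Vec.Membership.Propositional.Properties using (∈-lookup)
open import Data.Vec.Properties using (lookup-map; lookup-replicate)
open import Data.Vec.Relation.Unary.All as All using (All)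
open import Function using (id)
open import Level using (0ℓ; Lift; lift; lower) renaming (suc to lsuc)
open import Relation.Binary.PropositionalEquality using (_≡_; _≢_; refl; sym; trans; cong; cong₂; subst; subst₂; module ≡-Reasoning)
open import Relation.Binary.Structures using (IsTotalOrder)
open import Relation.Nullary using (¬_; yes; no; contradiction)
open import Relation.Nullary.Decidable.Core using (map′; dec⇒maybe; decidable-stable; toSum)
open import Relation.Unary using (Pred; U; ∁; ⋃; _∈_; _⊆_; _≐_; _∩_; _∪_; _⊢_)

-- Ring and order arithmetic over the axiomatic reals.

module RealField (𝓡 : CompleteOrderedField) where
  open Regression 𝓡
  open IsCommutativeRing isCommutativeRing public
    using (+-identityˡ; +-identityʳ; +-assoc; +-comm; *-identityˡ; *-identityʳ; distribʳ; zeroˡ; zeroʳ; -‿inverseʳ)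
  open IsTotalOrder isTotalOrder public using (total; antisym)
    renaming (refl to ≤-refl; trans to ≤-trans; reflexive to ≤-reflexive)

  commutativeRing : CommutativeRing 0ℓ 0ℓ
  commutativeRing = record { isCommutativeRing = isCommutativeRing }

  open RingProperties (CommutativeRing.ring commutativeRing)
    public using (-‿+-comm; -‿distribˡ-*; -‿distribʳ-*; -‿involutive; -0#≈0#)

  fromℕ-+ : ∀ m n → fromℕ (m ℕ.+ n) ≡ fromℕ m + fromℕ n
  fromℕ-+ zero    n = sym (+-identityˡ _)
  fromℕ-+ (suc m) n = trans (cong (λ z → 1# + z) (fromℕ-+ m n)) (sym (+-assoc _ _ _))

  fromℕ-* : ∀ m n → fromℕ (m ℕ.* n) ≡ fromℕ m * fromℕ n
  fromℕ-* zero    n = sym (zeroˡ _)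
  fromℕ-* (suc m) n = begin
    fromℕ (n ℕ.+ m ℕ.* n)           ≡⟨ fromℕ-+ n (m ℕ.* n) ⟩
    fromℕ n + fromℕ (m ℕ.* n)       ≡⟨ cong₂ _+_ (sym (*-identityˡ _)) (fromℕ-* m n) ⟩
    1# * fromℕ n + fromℕ m * fromℕ n ≡⟨ sym (distribʳ _ _ _) ⟩
    (1# + fromℕ m) * fromℕ n        ∎
    where open ≡-Reasoning

  -- fromℕ 1 is 1# + 0#; this variant sends 1 to 1# itself, so that 1# is a
  -- constant of the ring solver.
  fromℕ′ : ℕ → ℝ
  fromℕ′ 0             = 0#
  fromℕ′ 1             = 1#
  fromℕ′ (suc (suc n)) = 1# + fromℕ′ (suc n)

  fromℕ′≡fromℕ : ∀ n → fromℕ′ n ≡ fromℕ n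
  fromℕ′≡fromℕ 0             = refl
  fromℕ′≡fromℕ 1             = sym (+-identityʳ 1#)
  fromℕ′≡fromℕ (suc (suc n)) = cong (λ z → 1# + z) (fromℕ′≡fromℕ (suc n))

  fromℤ : ℤ → ℝ
  fromℤ (+ n)    = fromℕ′ n
  fromℤ -[1+ n ] = - fromℕ′ (suc n)

  fromℤ-⊖ : ∀ m n → fromℤ (m ℤ.⊖ n) ≡ fromℕ m - fromℕ n
  fromℤ-⊖ m       zero    =
    trans (fromℕ′≡fromℕ m) (trans (sym (+-identityʳ _)) (cong (λ z → fromℕ m + z) (sym -0#≈0#)))
  fromℤ-⊖ zero    (suc n) = trans (cong -_ (fromℕ′≡fromℕ (suc n))) (sym (+-identityˡ _))
  fromℤ-⊖ (suc m) (suc n) = begin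
    fromℤ (suc m ℤ.⊖ suc n)               ≡⟨ cong fromℤ (ℤ.[1+m]⊖[1+n]≡m⊖n m n) ⟩
    fromℤ (m ℤ.⊖ n)                       ≡⟨ fromℤ-⊖ m n ⟩
    a - b                                 ≡⟨ cong (_- b) (sym (+-identityʳ a)) ⟩
    a + 0# - b                            ≡⟨ cong (λ z → a + z - b) (sym (-‿inverseʳ 1#)) ⟩
    a + (1# - 1#) - b                     ≡⟨ cong (_- b) (sym (+-assoc _ _ _)) ⟩
    a + 1# - 1# - b                       ≡⟨ +-assoc _ _ _ ⟩
    a + 1# + (- 1# + - b)                 ≡⟨ cong₂ _+_ (+-comm _ _) (-‿+-comm 1# b) ⟩
    1# + a - (1# + b)                     ∎
    where
    open ≡-Reasoning
    a = fromℕ m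
    b = fromℕ n

  fromℤ-neg◃ : ∀ n → fromℤ (Sign.- ℤ.◃ n) ≡ - fromℕ n
  fromℤ-neg◃ zero    = sym -0#≈0#
  fromℤ-neg◃ (suc n) = cong -_ (fromℕ′≡fromℕ (suc n))

  fromℤ-pos◃ : ∀ n → fromℤ (Sign.+ ℤ.◃ n) ≡ fromℕ n
  fromℤ-pos◃ zero    = refl
  fromℤ-pos◃ (suc n) = fromℕ′≡fromℕ (suc n)

  fromℤ-+ : ∀ i j → fromℤ (i ℤ.+ j) ≡ fromℤ i + fromℤ j
  fromℤ-+ (+ m) (+ n) = trans (fromℕ′≡fromℕ (m ℕ.+ n)) (trans (fromℕ-+ m n)
    (cong₂ _+_ (sym (fromℕ′≡fromℕ m)) (sym (fromℕ′≡fromℕ n))))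
  fromℤ-+ (+ m) -[1+ n ] = trans (fromℤ-⊖ m (suc n))
    (cong₂ _-_ (sym (fromℕ′≡fromℕ m)) (sym (fromℕ′≡fromℕ (suc n))))
  fromℤ-+ -[1+ m ] (+ n) = trans (fromℤ-⊖ n (suc m)) (trans
    (cong₂ _-_ (sym (fromℕ′≡fromℕ n)) (sym (fromℕ′≡fromℕ (suc m)))) (+-comm _ _))
  fromℤ-+ -[1+ m ] -[1+ n ] = begin
    - fromℕ′ (suc (suc (m ℕ.+ n)))     ≡⟨ cong -_ (fromℕ′≡fromℕ (suc (suc (m ℕ.+ n)))) ⟩
    - fromℕ (suc (suc (m ℕ.+ n)))      ≡⟨ cong (λ k → - fromℕ (suc k)) (sym (ℕ.+-suc m n)) ⟩
    - fromℕ (suc m ℕ.+ suc n)          ≡⟨ cong -_ (fromℕ-+ (suc m) (suc n)) ⟩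
    - (fromℕ (suc m) + fromℕ (suc n))  ≡⟨ sym (-‿+-comm _ _) ⟩
    - fromℕ (suc m) - fromℕ (suc n)    ≡⟨ sym (cong₂ (λ a b → - a - b) (fromℕ′≡fromℕ (suc m)) (fromℕ′≡fromℕ (suc n))) ⟩
    - fromℕ′ (suc m) - fromℕ′ (suc n)  ∎
    where open ≡-Reasoning

  fromℤ-* : ∀ i j → fromℤ (i ℤ.* j) ≡ fromℤ i * fromℤ j
  fromℤ-* (+ m) (+ n) = trans (fromℤ-pos◃ (m ℕ.* n)) (trans (fromℕ-* m n)
    (sym (cong₂ _*_ (fromℕ′≡fromℕ m) (fromℕ′≡fromℕ n))))
  fromℤ-* (+ m) -[1+ n ] = begin
    fromℤ (Sign.- ℤ.◃ (m ℕ.* suc n))  ≡⟨ fromℤ-neg◃ (m ℕ.* suc n) ⟩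
    - fromℕ (m ℕ.* suc n)             ≡⟨ cong -_ (fromℕ-* m (suc n)) ⟩
    - (fromℕ m * fromℕ (suc n))       ≡⟨ -‿distribʳ-* _ _ ⟩
    fromℕ m * - fromℕ (suc n)         ≡⟨ sym (cong₂ (λ a b → a * - b) (fromℕ′≡fromℕ m) (fromℕ′≡fromℕ (suc n))) ⟩
    fromℕ′ m * - fromℕ′ (suc n)       ∎
    where open ≡-Reasoning
  fromℤ-* -[1+ m ] (+ n) = begin
    fromℤ (Sign.- ℤ.◃ (suc m ℕ.* n))  ≡⟨ fromℤ-neg◃ (suc m ℕ.* n) ⟩
    - fromℕ (suc m ℕ.* n)             ≡⟨ cong -_ (fromℕ-* (suc m) n) ⟩
    - (fromℕ (suc m) * fromℕ n)       ≡⟨ -‿distribˡ-* _ _ ⟩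
    - fromℕ (suc m) * fromℕ n         ≡⟨ sym (cong₂ (λ a b → - a * b) (fromℕ′≡fromℕ (suc m)) (fromℕ′≡fromℕ n)) ⟩
    - fromℕ′ (suc m) * fromℕ′ n       ∎
    where open ≡-Reasoning
  fromℤ-* -[1+ m ] -[1+ n ] = begin
    fromℕ′ (suc m ℕ.* suc n)              ≡⟨ fromℕ′≡fromℕ (suc m ℕ.* suc n) ⟩
    fromℕ (suc m ℕ.* suc n)               ≡⟨ fromℕ-* (suc m) (suc n) ⟩
    a * b                                 ≡⟨ sym (-‿involutive _) ⟩
    - - (a * b)                           ≡⟨ cong -_ (-‿distribˡ-* a b) ⟩
    - (- a * b)                           ≡⟨ -‿distribʳ-* (- a) b ⟩
    - a * - b                             ≡⟨ sym (cong₂ (λ x y → - x * - y) (fromℕ′≡fromℕ (suc m)) (fromℕ′≡fromℕ (suc n))) ⟩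
    - fromℕ′ (suc m) * - fromℕ′ (suc n)   ∎
    where
    open ≡-Reasoning
    a = fromℕ (suc m)
    b = fromℕ (suc n)

  fromℤ-neg : ∀ i → fromℤ (ℤ.- i) ≡ - fromℤ i
  fromℤ-neg (+ zero)  = sym -0#≈0#
  fromℤ-neg (+ suc n) = refl
  fromℤ-neg -[1+ n ]  = sym (-‿involutive _)

  -- Gives the ring solver integer coefficients, whose equality can be decided by computation, so
  -- that numerical constants cancel during normalisation.
  fromℤ-homomorphism : ℤ.+-*-rawRing -Raw-AlmostCommutative⟶ fromCommutativeRing commutativeRing
  fromℤ-homomorphism = record
    { ⟦_⟧ = fromℤ ; +-homo = fromℤ-+ ; *-homo = fromℤ-* ; -‿homo = fromℤ-neg
    ; 0-homo = refl ; 1-homo = refl }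

  open RingSolver ℤ.+-*-rawRing (fromCommutativeRing commutativeRing) fromℤ-homomorphism
    (λ i j → Maybe.map (cong fromℤ) (dec⇒maybe (i ℤ.≟ j))) public
    using (Polynomial; con; solve; _:+_; _:*_; _:-_; :-_; _:=_)

  +-mono-≤ : ∀ {x y u v} → x ≤ y → u ≤ v → x + u ≤ y + v
  +-mono-≤ {x} {y} {u} {v} x≤y u≤v = ≤-trans (+-monoˡ-≤ x y u x≤y)
    (subst₂ _≤_ (+-comm u y) (+-comm v y) (+-monoˡ-≤ u v y u≤v))

  x≤y⇒0≤y-x : ∀ {x y} → x ≤ y → 0# ≤ y - x
  x≤y⇒0≤y-x {x} {y} x≤y = subst (_≤ y - x) (-‿inverseʳ x) (+-monoˡ-≤ x y (- x) x≤y)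

  -- The standard form of an inequality proof below: the excess `e` is assembled from nonnegative
  -- pieces with `_⊕_` and `_⊛_`, and the ring solver checks that it is the difference of the two
  -- sides.
  0≤e⇒x≤x+e : ∀ {x y e} → 0# ≤ e → y ≡ x + e → x ≤ y
  0≤e⇒x≤x+e {x} 0≤e refl = subst (_≤ x + _) (+-identityʳ x) (+-mono-≤ ≤-refl 0≤e)

  infixl 6 _⊕_
  infixl 7 _⊛_

  _⊕_ : ∀ {x y} → 0# ≤ x → 0# ≤ y → 0# ≤ x + y
  0≤x ⊕ 0≤y = subst (_≤ _) (+-identityˡ 0#) (+-mono-≤ 0≤x 0≤y)

  _⊛_ : ∀ {x y} → 0# ≤ x → 0# ≤ y → 0# ≤ x * y
  _⊛_ {x} {y} = *-nonNeg x y

  neg-antimono-≤ : ∀ {x y} → x ≤ y → - y ≤ - x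
  neg-antimono-≤ {x} {y} x≤y = 0≤e⇒x≤x+e (x≤y⇒0≤y-x x≤y)
    (solve 2 (λ x y → :- x := :- y :+ (y :- x)) refl x y)

  x≤0⇒0≤-x : ∀ {x} → x ≤ 0# → 0# ≤ - x
  x≤0⇒0≤-x {x} x≤0 = subst (_≤ - x) -0#≈0# (neg-antimono-≤ x≤0)

  0≤x*x : ∀ x → 0# ≤ x * x
  0≤x*x x with total 0# x
  ... | inj₁ 0≤x = 0≤x ⊛ 0≤x
  ... | inj₂ x≤0 = subst (0# ≤_) (solve 1 (λ x → :- x :* :- x := x :* x) refl x)
                     (x≤0⇒0≤-x x≤0 ⊛ x≤0⇒0≤-x x≤0)

  0≤1 : 0# ≤ 1#
  0≤1 = subst (0# ≤_) (*-identityˡ 1#) (0≤x*x 1#)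

  1≰0 : ¬ 1# ≤ 0#
  1≰0 1≤0 = 0≢1 (antisym 0≤1 1≤0)

  0≤fromℕ : ∀ n → 0# ≤ fromℕ n
  0≤fromℕ zero    = ≤-refl
  0≤fromℕ (suc n) = 0≤1 ⊕ 0≤fromℕ n

  fromℕ-mono-≤ : ∀ {m n} → m ≤ℕ n → fromℕ m ≤ fromℕ n
  fromℕ-mono-≤ {n = n} ℕ.z≤n = 0≤fromℕ n
  fromℕ-mono-≤ (ℕ.s≤s m≤n) = +-mono-≤ ≤-refl (fromℕ-mono-≤ m≤n)

  <⇒≱ : ∀ {x y} → x < y → ¬ y ≤ x
  <⇒≱ (x≤y , x≢y) y≤x = x≢y (antisym x≤y y≤x)

  ≰⇒> : ∀ {x y} → ¬ x ≤ y → y < x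
  ≰⇒> {x} {y} x≰y with total x y
  ... | inj₁ x≤y = contradiction x≤y x≰y
  ... | inj₂ y≤x = y≤x , λ y≡x → x≰y (≤-reflexive (sym y≡x))

  0<1+x : ∀ {x} → 0# ≤ x → 0# < 1# + x
  0<1+x {x} 0≤x = ≰⇒> λ 1+x≤0 → 1≰0 (≤-trans (0≤e⇒x≤x+e 0≤x refl) 1+x≤0)

  ∣x∣≤b : ∀ {x b} → x ≤ b → - x ≤ b → ∣ x ∣ ≤ b
  ∣x∣≤b {x} x≤b -x≤b with total 0# x
  ... | inj₁ _ = x≤b
  ... | inj₂ _ = -x≤b

  x≤∣x∣ : ∀ x → x ≤ ∣ x ∣
  x≤∣x∣ x with total 0# x
  ... | inj₁ _   = ≤-refl
  ... | inj₂ x≤0 = ≤-trans x≤0 (x≤0⇒0≤-x x≤0)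

  -x≤∣x∣ : ∀ x → - x ≤ ∣ x ∣
  -x≤∣x∣ x with total 0# x
  ... | inj₁ 0≤x = ≤-trans (neg-antimono-≤ 0≤x) (subst (_≤ x) (sym -0#≈0#) 0≤x)
  ... | inj₂ _   = ≤-refl

  *-inverse-pos : ∀ {x} → 0# < x → x * x ⁻¹ ≡ 1#
  *-inverse-pos {x} (_ , 0≢x) = *-inverse x λ x≡0 → 0≢x (sym x≡0)

  -- If the inverse were nonpositive, then 0 = x x⁻¹ + x (- x⁻¹) would be 1 plus something
  -- nonnegative.
  0≤x⁻¹ : ∀ {x} → 0# < x → 0# ≤ x ⁻¹
  0≤x⁻¹ {x} 0<x@(0≤x , _) with total 0# (x ⁻¹)
  ... | inj₁ 0≤i = 0≤i
  ... | inj₂ i≤0 = contradiction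
    (0≤e⇒x≤x+e (0≤x ⊛ x≤0⇒0≤-x i≤0) (trans
      (solve 2 (λ x i → con (+ 0) := x :* i :+ x :* :- i) refl x (x ⁻¹))
      (cong (_+ x * - x ⁻¹) (*-inverse-pos 0<x))))
    1≰0

  *-cancelˡ-≤ : ∀ {k x y} → 0# < k → k * x ≤ k * y → x ≤ y
  *-cancelˡ-≤ {k} {x} {y} 0<k kx≤ky =
    subst₂ _≤_ (k⁻¹[kz]≡z x) (k⁻¹[kz]≡z y) (0≤e⇒x≤x+e (0≤x⁻¹ 0<k ⊛ x≤y⇒0≤y-x kx≤ky)
      (solve 3 (λ i a b → i :* b := i :* a :+ i :* (b :- a)) refl (k ⁻¹) (k * x) (k * y)))
    where
    k⁻¹[kz]≡z : ∀ z → k ⁻¹ * (k * z) ≡ z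
    k⁻¹[kz]≡z z = trans (solve 3 (λ i k z → i :* (k :* z) := (k :* i) :* z) refl (k ⁻¹) k z)
      (trans (cong (_* z) (*-inverse-pos 0<k)) (*-identityˡ z))

-- Chebyshev polynomials: boundedness, growth and monotonicity.

module Chebyshev (𝓡 : CompleteOrderedField) where
  open Regression 𝓡
  open RealField 𝓡

  private
    :1 : ∀ {n} → Polynomial n
    :1 = con (+ 1)

  -- T n is the Chebyshev polynomial of the first kind and V (suc n) the one of
  -- the second kind of index n: they are cos nθ and sin nθ / sin θ at cos θ.
  mutual
    T V : ℕ → ℝ → ℝ
    T zero    y = 1#
    T (suc n) y = y * T n y - (1# - y * y) * V n y
    V zero    y = 0#
    V (suc n) y = y * V n y + T n y

  -- With w² = y² - 1, the recursion multiplies T + V w by y + w. The left side is the norm of T + V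
  -- w, and y + w has norm 1, so the norm never changes.
  pell : ∀ n y → T n y * T n y + (1# - y * y) * (V n y * V n y) ≡ 1#
  pell zero    y = solve 1 (λ y → :1 :* :1 :+ (:1 :- y :* y) :* (con (+ 0) :* con (+ 0)) := :1) refl y
  pell (suc n) y = trans
    (solve 3 (λ y T V →
      let T′ = y :* T :- (:1 :- y :* y) :* V ; V′ = y :* V :+ T in
      T′ :* T′ :+ (:1 :- y :* y) :* (V′ :* V′) := T :* T :+ (:1 :- y :* y) :* (V :* V))
      refl y (T n y) (V n y))
    (pell n y)

  x*x≤1⇒x≤1 : ∀ {x} → 0# ≤ 1# - x * x → x ≤ 1#
  x*x≤1⇒x≤1 {x} 0≤1-x² with total x 1#
  ... | inj₁ x≤1 = x≤1
  -- The three nonnegative terms 1 - x², (x - 1)² and x - 1 add up to 1 - x.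
  ... | inj₂ 1≤x = 0≤e⇒x≤x+e (0≤1-x² ⊕ 0≤x*x (x - 1#) ⊕ x≤y⇒0≤y-x 1≤x)
    (solve 1 (λ x → :1 := x :+ (:1 :- x :* x :+ (x :- :1) :* (x :- :1) :+ (x :- :1))) refl x)

  -- By `pell`, 1 - T² = (1 - y²) V², which is nonnegative on [-1,1].
  ∣T∣≤1 : ∀ n {y} → - 1# ≤ y → y ≤ 1# → ∣ T n y ∣ ≤ 1#
  ∣T∣≤1 n {y} -1≤y y≤1 = ∣x∣≤b (x*x≤1⇒x≤1 0≤1-T²)
    (x*x≤1⇒x≤1 (subst (0# ≤_) (solve 1 (λ x → :1 :- x :* x := :1 :- :- x :* :- x) refl (T n y)) 0≤1-T²))
    where
    0≤1-y² : 0# ≤ 1# - y * y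
    0≤1-y² = subst (0# ≤_) (solve 1 (λ y → (:1 :- y) :* (y :- :- :1) := :1 :- y :* y) refl y)
      (x≤y⇒0≤y-x y≤1 ⊛ x≤y⇒0≤y-x -1≤y)
    0≤1-T² : 0# ≤ 1# - T n y * T n y
    0≤1-T² = subst (0# ≤_)
      (trans (solve 3 (λ y T V → (:1 :- y :* y) :* (V :* V) := T :* T :+ (:1 :- y :* y) :* (V :* V) :- T :* T) refl y (T n y) (V n y))
             (cong (_- T n y * T n y) (pell n y)))
      (0≤1-y² ⊛ 0≤x*x (V n y))

  -- The bounds are read off at y = 1, where `V n` equals n and `T n` has value 1 and slope n². For
  -- y ≥ 1 each recursion combines T and V with nonnegative coefficients, so the two inductions run
  -- together.
  V-growth : ∀ n {y} → 1# ≤ y → fromℕ n ≤ V n y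
  T-growth : ∀ n {y} → 1# ≤ y → 1# + fromℕ n * fromℕ n * (y - 1#) ≤ T n y
  V-growth zero        1≤y = ≤-refl
  V-growth (suc n) {y} 1≤y = 0≤e⇒x≤x+e
    (0≤f ⊕ 0≤t ⊛ (0≤f ⊕ 0≤fromℕ n) ⊕ 0≤e ⊕ 0≤fromℕ n ⊛ 0≤fromℕ n ⊛ 0≤t)
    (solve 4 (λ y N T V → y :* V :+ T := :1 :+ N :+ ((V :- N) :+ (y :- :1) :* ((V :- N) :+ N)
        :+ (T :- (:1 :+ N :* N :* (y :- :1))) :+ N :* N :* (y :- :1)))
      refl y (fromℕ n) (T n y) (V n y))
    where
    0≤t = x≤y⇒0≤y-x 1≤y
    0≤e = x≤y⇒0≤y-x (T-growth n 1≤y)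
    0≤f = x≤y⇒0≤y-x (V-growth n 1≤y)
  T-growth zero    {y} 1≤y = ≤-reflexive (solve 1 (λ y → :1 :+ con (+ 0) :* con (+ 0) :* (y :- :1) := :1) refl y)
  T-growth (suc n) {y} 1≤y = 0≤e⇒x≤x+e
    -- With t = y - 1 and e, f the slacks in the induction hypotheses for T and V, the new slack is
    -- N² t² + y e + N t² + (y² - 1) f.
    (0≤N ⊛ 0≤N ⊛ (0≤t ⊛ 0≤t) ⊕ 0≤y ⊛ 0≤e ⊕ 0≤t ⊛ 0≤t ⊛ 0≤N ⊕ 0≤t ⊛ (0≤1 ⊕ 0≤y) ⊛ 0≤f)
    (solve 4 (λ y N T V → let t = y :- :1 in
        y :* T :- (:1 :- y :* y) :* V := :1 :+ (:1 :+ N) :* (:1 :+ N) :* t :+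
        (N :* N :* (t :* t) :+ y :* (T :- (:1 :+ N :* N :* t)) :+ t :* t :* N :+ t :* (:1 :+ y) :* (V :- N)))
      refl y (fromℕ n) (T n y) (V n y))
    where
    0≤N = 0≤fromℕ n
    0≤y = ≤-trans 0≤1 1≤y
    0≤t = x≤y⇒0≤y-x 1≤y
    0≤e = x≤y⇒0≤y-x (T-growth n 1≤y)
    0≤f = x≤y⇒0≤y-x (V-growth n 1≤y)

  0≤V : ∀ n {y} → 1# ≤ y → 0# ≤ V n y
  0≤V n 1≤y = ≤-trans (0≤fromℕ n) (V-growth n 1≤y)

  0≤T : ∀ n {y} → 1# ≤ y → 0# ≤ T n y
  0≤T n 1≤y = ≤-trans (0≤1 ⊕ 0≤fromℕ n ⊛ 0≤fromℕ n ⊛ x≤y⇒0≤y-x 1≤y) (T-growth n 1≤y)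

  -- The coefficients of both recursions are nonnegative and increasing beyond 1; the difference of
  -- two products is split by changing one factor at a time. Monotonicity later makes the
  -- adversary's answers Borel measurable.
  V-mono : ∀ n {x y} → 1# ≤ x → x ≤ y → V n x ≤ V n y
  T-mono : ∀ n {x y} → 1# ≤ x → x ≤ y → T n x ≤ T n y
  V-mono zero            1≤x x≤y = ≤-refl
  V-mono (suc n) {x} {y} 1≤x x≤y = 0≤e⇒x≤x+e
    (x≤y⇒0≤y-x x≤y ⊛ 0≤V n (≤-trans 1≤x x≤y) ⊕ ≤-trans 0≤1 1≤x ⊛ x≤y⇒0≤y-x (V-mono n 1≤x x≤y)
      ⊕ x≤y⇒0≤y-x (T-mono n 1≤x x≤y))
    (solve 6 (λ x y Tx Ty Vx Vy → y :* Vy :+ Ty :=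
        x :* Vx :+ Tx :+ ((y :- x) :* Vy :+ x :* (Vy :- Vx) :+ (Ty :- Tx)))
      refl x y (T n x) (T n y) (V n x) (V n y))
  T-mono zero            1≤x x≤y = ≤-refl
  T-mono (suc n) {x} {y} 1≤x x≤y = 0≤e⇒x≤x+e
    (0≤y-x ⊛ 0≤T n 1≤y ⊕ 0≤x ⊛ x≤y⇒0≤y-x (T-mono n 1≤x x≤y) ⊕ 0≤y-x ⊛ (≤-trans 0≤1 1≤y ⊕ 0≤x) ⊛ 0≤V n 1≤y
      ⊕ x≤y⇒0≤y-x 1≤x ⊛ (0≤1 ⊕ 0≤x) ⊛ x≤y⇒0≤y-x (V-mono n 1≤x x≤y))
    (solve 6 (λ x y Tx Ty Vx Vy → y :* Ty :- (:1 :- y :* y) :* Vy :=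
        x :* Tx :- (:1 :- x :* x) :* Vx :+
        ((y :- x) :* Ty :+ x :* (Ty :- Tx) :+ (y :- x) :* (y :+ x) :* Vy :+ (x :- :1) :* (:1 :+ x) :* (Vy :- Vx)))
      refl x y (T n x) (T n y) (V n x) (V n y))
    where
    0≤x   = ≤-trans 0≤1 1≤x
    1≤y   = ≤-trans 1≤x x≤y
    0≤y-x = x≤y⇒0≤y-x x≤y

  -- Coefficient vectors of the shifted Chebyshev polynomials.

  -- Evaluation for vectors of every length, including the empty one, so that inductions on
  -- coefficient vectors can start; on `Poly≤ d` it agrees with `⟦_⟧` by definition.
  horner : ∀ {n} → Vec ℝ n → ℝ → ℝ
  horner p x = foldr′ (λ a acc → a + x * acc) 0# p

  horner-+ : ∀ {n} (p q : Vec ℝ n) x → horner (zipWith _+_ p q) x ≡ horner p x + horner q x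
  horner-+ []      []      x = solve 0 (con (+ 0) := con (+ 0) :+ con (+ 0)) refl
  horner-+ (a ∷ p) (b ∷ q) x = trans (cong (λ h → a + b + x * h) (horner-+ p q x))
    (solve 5 (λ a b x h k → a :+ b :+ x :* (h :+ k) := a :+ x :* h :+ (b :+ x :* k)) refl a b x (horner p x) (horner q x))

  horner-* : ∀ {n} c (p : Vec ℝ n) x → horner (map (c *_) p) x ≡ c * horner p x
  horner-* c []      x = solve 1 (λ c → con (+ 0) := c :* con (+ 0)) refl c
  horner-* c (a ∷ p) x = trans (cong (λ h → c * a + x * h) (horner-* c p x))
    (solve 4 (λ c a x h → c :* a :+ x :* (c :* h) := c :* (a :+ x :* h)) refl c a x (horner p x))

  horner-∷ʳ0 : ∀ {n} (p : Vec ℝ n) x → horner (p ∷ʳ 0#) x ≡ horner p x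
  horner-∷ʳ0 []      x = solve 1 (λ x → con (+ 0) :+ x :* con (+ 0) := con (+ 0)) refl x
  horner-∷ʳ0 (a ∷ p) x = cong (λ h → a + x * h) (horner-∷ʳ0 p x)

  horner-0 : ∀ n x → horner (replicate n 0#) x ≡ 0#
  horner-0 zero    x = refl
  horner-0 (suc n) x = trans (cong (λ h → 0# + x * h) (horner-0 n x))
    (solve 1 (λ x → con (+ 0) :+ x :* con (+ 0) := con (+ 0)) refl x)

  -- Eliminates V, so that the coefficients can be computed from those of T alone.
  T-three-term : ∀ n y → T (suc (suc n)) y ≡ (1# + 1#) * y * T (suc n) y - T n y
  T-three-term n y = solve 3 (λ y T V → let T′ = y :* T :- (:1 :- y :* y) :* V in
      y :* T′ :- (:1 :- y :* y) :* (y :* V :+ T) := (:1 :+ :1) :* y :* T′ :- T)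
    refl y (T n y) (V n y)

  -- The three-term recursion at x + δ, with 2 (x + δ) split into 2 x and 2 δ. The zero in front
  -- multiplies by x; the zeros at the end only bring the vectors to a common length.
  shiftedT : ℝ → ∀ n → Poly≤ n
  shiftedT δ zero          = 1# ∷ []
  shiftedT δ (suc zero)    = δ ∷ 1# ∷ []
  shiftedT δ (suc (suc n)) = zipWith _+_
    (zipWith _+_ (0# ∷ map ((1# + 1#) *_) (shiftedT δ (suc n)))
                  (map ((1# + 1#) * δ *_) (shiftedT δ (suc n) ∷ʳ 0#)))
    (map (- 1# *_) (shiftedT δ n ∷ʳ 0# ∷ʳ 0#))

  ⟦shiftedT⟧ : ∀ δ n x → ⟦ shiftedT δ n ⟧ x ≡ T n (x + δ)
  ⟦shiftedT⟧ δ zero x = solve 1 (λ x → :1 :+ x :* con (+ 0) := :1) refl x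
  ⟦shiftedT⟧ δ (suc zero) x = solve 2 (λ δ x → δ :+ x :* (:1 :+ x :* con (+ 0)) :=
      (x :+ δ) :* :1 :- (:1 :- (x :+ δ) :* (x :+ δ)) :* con (+ 0)) refl δ x
  ⟦shiftedT⟧ δ (suc (suc n)) x = begin
    horner (zipWith _+_ (zipWith _+_ (0# ∷ map (2# *_) p) (map (2# * δ *_) (p ∷ʳ 0#))) (map (- 1# *_) (q ∷ʳ 0# ∷ʳ 0#))) x
      ≡⟨ horner-+ (zipWith _+_ (0# ∷ map (2# *_) p) (map (2# * δ *_) (p ∷ʳ 0#))) (map (- 1# *_) (q ∷ʳ 0# ∷ʳ 0#)) x ⟩
    horner (zipWith _+_ (0# ∷ map (2# *_) p) (map (2# * δ *_) (p ∷ʳ 0#))) x + horner (map (- 1# *_) (q ∷ʳ 0# ∷ʳ 0#)) x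
      ≡⟨ cong (λ z → z + horner (map (- 1# *_) (q ∷ʳ 0# ∷ʳ 0#)) x)
           (horner-+ (0# ∷ map (2# *_) p) (map (2# * δ *_) (p ∷ʳ 0#)) x) ⟩
    0# + x * horner (map (2# *_) p) x + horner (map (2# * δ *_) (p ∷ʳ 0#)) x + horner (map (- 1# *_) (q ∷ʳ 0# ∷ʳ 0#)) x
      ≡⟨ cong₂ _+_ (cong₂ (λ a b → 0# + x * a + b) (scaled 2# p refl) (scaled (2# * δ) (p ∷ʳ 0#) (horner-∷ʳ0 p x)))
           (scaled (- 1#) (q ∷ʳ 0# ∷ʳ 0#) (trans (horner-∷ʳ0 (q ∷ʳ 0#) x) (horner-∷ʳ0 q x))) ⟩
    0# + x * (2# * horner p x) + 2# * δ * horner p x + - 1# * horner q x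
      ≡⟨ cong₂ (λ a b → 0# + x * (2# * a) + 2# * δ * a + - 1# * b) (⟦shiftedT⟧ δ (suc n) x) (⟦shiftedT⟧ δ n x) ⟩
    0# + x * (2# * T (suc n) (x + δ)) + 2# * δ * T (suc n) (x + δ) + - 1# * T n (x + δ)
      ≡⟨ solve 4 (λ x δ a b → con (+ 0) :+ x :* ((:1 :+ :1) :* a) :+ (:1 :+ :1) :* δ :* a :+ :- :1 :* b :=
           (:1 :+ :1) :* (x :+ δ) :* a :- b) refl x δ (T (suc n) (x + δ)) (T n (x + δ)) ⟩
    2# * (x + δ) * T (suc n) (x + δ) - T n (x + δ)
      ≡⟨ sym (T-three-term n (x + δ)) ⟩
    T (suc (suc n)) (x + δ) ∎
    where
    open ≡-Reasoning
    2# = 1# + 1#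
    p  = shiftedT δ (suc n)
    q  = shiftedT δ n
    scaled : ∀ {m} c (r : Vec ℝ m) {a} → horner r x ≡ a → horner (map (c *_) r) x ≡ c * a
    scaled c r eq = trans (horner-* c r x) (cong (c *_) eq)

-- Classical logic.

module Classical (em : ExcludedMiddle (lsuc 0ℓ)) where

  -- `Pr[_]>_` quantifies over sets and so lives one universe up, where `em` decides it; the other
  -- case distinctions concern small propositions.
  em₀ : ExcludedMiddle 0ℓ
  em₀ {P} = map′ lower lift (em {Lift (lsuc 0ℓ) P})

  stable : ∀ {P : Set} → ¬ ¬ P → P
  stable = decidable-stable em₀

-- Completeness, limits and measurability of monotone maps.

module BorelSets (em : ExcludedMiddle (lsuc 0ℓ)) (𝓡 : CompleteOrderedField) where
  open Classical em
  open Regression 𝓡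
  open RealField 𝓡

  -- Otherwise the naturals would have a least upper bound b, and b - 1 would be an upper bound as
  -- well, since n + 1 ≤ b for every n.
  archimedean : ∀ x → ∃[ n ] x ≤ fromℕ n
  archimedean x = stable λ none →
    let bounded : UpperBound S x
        bounded = λ where
          _ (n , refl) → [ id , (λ x≤n → contradiction (n , x≤n) none) ]′ (total (fromℕ n) x)
        b , upper , least = complete S (fromℕ 0 , 0 , refl) (x , bounded)
        b≤b-1 = least (b - 1#) λ where
          _ (n , refl) → 0≤e⇒x≤x+e (x≤y⇒0≤y-x (upper _ (suc n , refl)))
            (solve 2 (λ b m → b :- con (+ 1) := m :+ (b :- (con (+ 1) :+ m))) refl b (fromℕ n))
    in 1≰0 (0≤e⇒x≤x+e (x≤y⇒0≤y-x b≤b-1)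
         (solve 1 (λ b → con (+ 0) := con (+ 1) :+ (b :- con (+ 1) :- b)) refl b))
    where
    S : Pred ℝ 0ℓ
    S y = ∃[ n ] y ≡ fromℕ n

  x≤ε⇒x≤0 : ∀ {x} → (∀ ε → 0# < ε → x ≤ ε) → x ≤ 0#
  x≤ε⇒x≤0 {x} x≤ε = stable λ x≰0 →
    -- The hypothesis is tested at half of x.
    let 0<ε : 0# < x * h
        0<ε = ≰⇒> λ xh≤0 → x≰0 (0≤e⇒x≤x+e (x≤0⇒0≤-x xh≤0 ⊕ x≤0⇒0≤-x xh≤0)
                (trans (solve 1 (λ y → con (+ 0) := y :+ y :+ (:- y :+ :- y)) refl (x * h))
                       (cong (_+ (- (x * h) + - (x * h))) x≡2xh)))
    in x≰0 (0≤e⇒x≤x+e (x≤y⇒0≤y-x (x≤ε _ 0<ε) ⊕ x≤y⇒0≤y-x (x≤ε _ 0<ε))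
         (trans (sym (-‿inverseʳ x)) (trans (cong (_- x) (sym x≡2xh))
           (solve 2 (λ x y → y :+ y :- x := x :+ ((y :- x) :+ (y :- x))) refl x (x * h)))))
    where
    2# = 1# + 1#
    h  = 2# ⁻¹
    x≡2xh : x * h + x * h ≡ x
    x≡2xh = trans (solve 2 (λ x h → x :* h :+ x :* h := x :* ((con (+ 1) :+ con (+ 1)) :* h)) refl x h)
      (trans (cong (x *_) (*-inverse-pos (0<1+x 0≤1))) (*-identityʳ x))

  -- Serves to extract finite additivity from countable additivity: the partial sums are constant
  -- once the remaining sets are empty.
  eventually-constant-limit : ∀ {u a l} k → (∀ n → u (k ℕ.+ n) ≡ a) → u ConvergesTo l → a ≡ l
  eventually-constant-limit {u} {a} {l} k u≡a u→l = antisym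
    (0≤e⇒x≤x+e (x≤0⇒0≤-x (x≤ε⇒x≤0 λ ε 0<ε → ≤-trans (x≤∣x∣ _) (close ε 0<ε)))
      (solve 2 (λ a l → l := a :+ :- (a :- l)) refl a l))
    (0≤e⇒x≤x+e (x≤0⇒0≤-x (x≤ε⇒x≤0 λ ε 0<ε → ≤-trans (-x≤∣x∣ _) (close ε 0<ε)))
      (solve 2 (λ a l → a := l :+ :- :- (a :- l)) refl a l))
    where
    close : ∀ ε → 0# < ε → ∣ a - l ∣ ≤ ε
    close ε 0<ε with N , near ← u→l ε 0<ε =
      subst (λ z → ∣ z - l ∣ ≤ ε) (u≡a N) (near (k ℕ.+ N) (ℕ.m≤n+m N k))

  -- Preimages commute with complements and countable unions, so an induction on the derivation of
  -- measurability suffices.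
  measurable-on-generators : ∀ {M : MeasurableSpace} {B : Set} {I : Set₁} {gen : I → Pred B 0ℓ} {f} →
    (∀ i → Measurable M (f ⊢ gen i)) → MeasurableMap M (generatedBy gen) f
  measurable-on-generators {M} {f = f} on-gen = go
    where
    open MeasurableSpace M
    go : ∀ {S} → σ⟨ _ ⟩ S → Measurable M (f ⊢ S)
    go (generator i)              = on-gen i
    go full                       = U-measurable
    go (complement mS)            = ∁-measurable (go mS)
    go (union mS)                 = ⋃-measurable λ n → go (mS n)
    go (resp-≐ (S⊆T , T⊆S) mS)    = measurable-≐ (S⊆T , T⊆S) (go mS)

  constant-measurable : ∀ (M N : MeasurableSpace) c → MeasurableMap M N (λ _ → c)
  constant-measurable M N c {S} _ with em₀ {S c}
  ... | yes c∈S = MeasurableSpace.measurable-≐ M ((λ _ → c∈S) , (λ _ → tt)) (MeasurableSpace.U-measurable M)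
  ... | no  c∉S = MeasurableSpace.measurable-≐ M ((λ ¬tt → contradiction tt ¬tt) , (λ c∈S → contradiction c∈S c∉S))
                    (MeasurableSpace.∁-measurable M (MeasurableSpace.U-measurable M))

  module _ {S : Pred ℝ 0ℓ} (down-closed : ∀ {x y} → x ≤ y → y ∈ S → x ∈ S) where

    ∉⇒UpperBound : ∀ {x} → ¬ x ∈ S → UpperBound S x
    ∉⇒UpperBound {x} x∉S y y∈S with total y x
    ... | inj₁ y≤x = y≤x
    ... | inj₂ x≤y = contradiction (down-closed x≤y y∈S) x∉S

    -- Such a set is empty, the whole line, or a ray ending at its supremum a. A closed ray is a
    -- generator; an open one is the union of the closed rays up to a - 1/(n+1).
    down-closed-measurable : Measurable Borel S
    down-closed-measurable with em₀ {∃[ x ] x ∈ S} | em₀ {∃[ b ] UpperBound S b}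
    ... | no empty | _ = resp-≐ ((λ ¬tt → contradiction tt ¬tt) , (λ x∈S → contradiction (_ , x∈S) empty)) (complement full)
    ... | _ | no unbounded =
      resp-≐ ((λ _ → stable λ x∉S → unbounded (_ , ∉⇒UpperBound x∉S)) , (λ _ → tt)) full
    ... | yes inhabited | yes bounded with complete S inhabited bounded
    ... | a , upper , least with em₀ {a ∈ S}
    ... | yes a∈S = resp-≐ ((λ x≤a → down-closed x≤a a∈S) , (λ x∈S → upper _ x∈S)) (generator (lift a))
    ... | no  a∉S = resp-≐ (ray⊆S , S⊆ray) (union λ n → generator (lift (a - fromℕ (suc n) ⁻¹)))
      where
      ray = ⋃ ℕ λ n x → x ≤ a - fromℕ (suc n) ⁻¹

      ray⊆S : ray ⊆ S
      -- A point outside S is an upper bound of S, and none lies below the least one.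
      ray⊆S {x} (n , x≤a-i) = stable λ x∉S → 1≰0 (subst (_≤ 0#) (*-inverse-pos 0<k)
        (0≤e⇒x≤x+e (proj₁ 0<k ⊛ x≤y⇒0≤y-x (≤-trans (least x (∉⇒UpperBound x∉S)) x≤a-i))
          (solve 3 (λ a k i → con (+ 0) := k :* i :+ k :* (a :- i :- a)) refl a k (k ⁻¹))))
        where
        k = fromℕ (suc n)
        0<k : 0# < k
        0<k = 0<1+x (0≤fromℕ n)

      S⊆ray : S ⊆ ray
      -- As a is not in S, a - x is positive; a natural number n above its inverse gives 1/(n+1) ≤ a
      -- - x.
      S⊆ray {x} x∈S with n , i≤n ← archimedean ((a - x) ⁻¹) = n ,
        0≤e⇒x≤x+e (x≤y⇒0≤y-x (*-cancelˡ-≤ 0<k (subst (_≤ k * (a - x)) (sym (*-inverse-pos 0<k)) 1≤ke)))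
          (solve 3 (λ a x i → a :- i := x :+ (a :- x :- i)) refl a x (k ⁻¹))
        where
        k = fromℕ (suc n)
        0<k : 0# < k
        0<k = 0<1+x (0≤fromℕ n)
        0<a-x : 0# < a - x
        0<a-x = ≰⇒> λ a-x≤0 → a∉S (down-closed (0≤e⇒x≤x+e (x≤0⇒0≤-x a-x≤0)
          (solve 2 (λ a x → x := a :+ :- (a :- x)) refl a x)) x∈S)
        1≤ke : 1# ≤ k * (a - x)
        1≤ke = subst (_≤ k * (a - x)) (*-inverse-pos 0<a-x)
          (0≤e⇒x≤x+e (proj₁ 0<a-x ⊛ x≤y⇒0≤y-x (≤-trans i≤n (0≤e⇒x≤x+e 0≤1 (+-comm 1# _))))
            (solve 3 (λ e i k → k :* e := e :* i :+ e :* (k :- i)) refl (a - x) ((a - x) ⁻¹) k))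

  -- The generators of `Borel` are rays, and a monotone map pulls a ray back to a down-closed set.
  monotone-measurable : ∀ {g} → (∀ {x y} → x ≤ y → g x ≤ g y) → MeasurableMap Borel Borel g
  monotone-measurable mono = measurable-on-generators {Borel} λ _ →
    down-closed-measurable λ x≤y gy≤t → ≤-trans (mono x≤y) gy≤t

  map-measurable : ∀ {M n g} → MeasurableMap Borel Borel g →
    MeasurableMap (M ⊗ Power Borel n) (Power Borel n) λ (_ , xs) → map g xs
  map-measurable {M} {n} {g} g-measurable = measurable-on-generators {M ⊗ Power Borel n} λ where
    (i , S , mS) → resp-≐
      ( (λ { {_ , xs} (_ , gx∈S) → subst S (sym (lookup-map i g xs)) gx∈S })
      , (λ { {_ , xs} gx∈S → tt , subst S (lookup-map i g xs) gx∈S }))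
      -- The preimage of a cylinder is a rectangle that leaves the seed unrestricted.
      (generator ((U , MeasurableSpace.U-measurable M) , (_ , generator (i , (g ⊢ S , g-measurable mS)))))

-- Finite additivity, monotonicity and the union bound.

module Probability (em : ExcludedMiddle (lsuc 0ℓ)) (𝓡 : CompleteOrderedField)
                   (𝓟 : Regression.ProbabilitySpace 𝓡) where
  open Classical em
  open Regression 𝓡
  open RealField 𝓡
  open BorelSets em 𝓡 using (x≤ε⇒x≤0; eventually-constant-limit)
  open ProbabilitySpace 𝓟
  open MeasurableSpace space using (U-measurable; ∁-measurable; ⋃-measurable; measurable-≐)

  ∅-measurable : Measurable space (∁ U)
  ∅-measurable = ∁-measurable U-measurable

  -- Additivity for the constant sequence of empty sets says that the multiples n e converge to e.
  -- At index N + 2 the distance is (N + 1) e, which is at least e, so e is below every positive ε.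
  prob-∅ : prob (∁ U) ≡ 0#
  prob-∅ = antisym (x≤ε⇒x≤0 e≤ε) (nonNeg ∅-measurable)
    where
    e = prob (∁ U)
    ∑e : ∀ n → ∑ n (λ _ → e) ≡ fromℕ n * e
    ∑e zero    = solve 1 (λ e → con (+ 0) := con (+ 0) :* e) refl e
    ∑e (suc n) = trans (cong (_+ e) (∑e n)) (solve 2 (λ n e → n :* e :+ e := (con (+ 1) :+ n) :* e) refl (fromℕ n) e)
    e-limit : (λ n → ∑ n (λ _ → e)) ConvergesTo e
    e-limit = subst (λ l → (λ n → ∑ n (λ _ → e)) ConvergesTo l)
      (prob-resp (⋃-measurable λ _ → ∅-measurable) ((λ (_ , ¬tt) → ¬tt) , (λ ¬tt → contradiction tt ¬tt)))
      (additive (λ _ → ∁ U) (λ _ → ∅-measurable) (λ _ _ _ _ (¬tt , _) → ¬tt tt))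
    e≤ε : ∀ ε → 0# < ε → e ≤ ε
    e≤ε ε 0<ε with N , near ← e-limit ε 0<ε = ≤-trans
      (0≤e⇒x≤x+e (0≤fromℕ N ⊛ nonNeg ∅-measurable)
        (trans (cong (_- e) (∑e (2 ℕ.+ N)))
          (solve 2 (λ n e → (con (+ 1) :+ (con (+ 1) :+ n)) :* e :- e := e :+ n :* e) refl (fromℕ N) e)))
      (≤-trans (x≤∣x∣ _) (near (2 ℕ.+ N) (ℕ.m≤n+m N 2)))

  module _ {A B : Pred Ω 0ℓ} (mA : Measurable space A) (mB : Measurable space B) where

    private
      -- Two sets padded with empty ones, to bring the binary case under the countable axioms.
      family : ℕ → Pred Ω 0ℓ
      family 0             = A
      family 1             = B
      family (suc (suc _)) = ∁ U

      family-measurable : ∀ n → Measurable space (family n)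
      family-measurable 0             = mA
      family-measurable 1             = mB
      family-measurable (suc (suc _)) = ∅-measurable

      ⋃family≐A∪B : ⋃ ℕ family ≐ (A ∪ B)
      ⋃family≐A∪B = (λ { (0 , a) → inj₁ a ; (1 , b) → inj₂ b ; (suc (suc _) , ¬tt) → contradiction tt ¬tt })
                  , [ (λ a → 0 , a) , (λ b → 1 , b) ]′

    ∪-measurable : Measurable space (A ∪ B)
    ∪-measurable = measurable-≐ ⋃family≐A∪B (⋃-measurable family-measurable)

    prob-disjoint-∪ : (∀ ω → ω ∈ A → ω ∈ B → ⊥) → prob (A ∪ B) ≡ prob A + prob B
    prob-disjoint-∪ disjoint = sym (trans
      (eventually-constant-limit 2 ∑-constant (additive family family-measurable family-disjoint))
      (prob-resp (⋃-measurable family-measurable) ⋃family≐A∪B))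
      where
      family-disjoint : ∀ m n → m ≢ n → ∀ ω → ¬ (ω ∈ family m × ω ∈ family n)
      family-disjoint 0 0 0≢0 _ _                     = 0≢0 refl
      family-disjoint 0 1 _ ω (a , b)                 = disjoint ω a b
      family-disjoint 1 0 _ ω (b , a)                 = disjoint ω a b
      family-disjoint 1 1 1≢1 _ _                     = 1≢1 refl
      family-disjoint (suc (suc _)) _ _ _ (¬tt , _)   = ¬tt tt
      family-disjoint 0 (suc (suc _)) _ _ (_ , ¬tt)   = ¬tt tt
      family-disjoint 1 (suc (suc _)) _ _ (_ , ¬tt)   = ¬tt tt
      ∑-constant : ∀ n → ∑ (2 ℕ.+ n) (λ k → prob (family k)) ≡ prob A + prob B
      ∑-constant zero    = cong (_+ prob B) (+-identityˡ _)
      ∑-constant (suc n) = trans (cong₂ _+_ (∑-constant n) prob-∅) (+-identityʳ _)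

  prob-∁ : ∀ {A} → Measurable space A → prob (∁ A) ≡ 1# - prob A
  prob-∁ {A} mA = trans (solve 2 (λ a b → b := a :+ b :- a) refl (prob A) (prob (∁ A)))
    (cong (_- prob A) (trans (sym (prob-disjoint-∪ mA (∁-measurable mA) λ _ a ¬a → ¬a a))
      (trans (prob-resp (∪-measurable mA (∁-measurable mA)) ((λ _ → tt) , (λ _ → toSum em₀))) total-prob)))
    where total-prob = ProbabilitySpace.total 𝓟

  -- By De Morgan the difference is the complement of `∁ B ∪ A`, which uses only complements and
  -- unions.
  ∖-measurable : ∀ {A B} → Measurable space A → Measurable space B → Measurable space (B ∩ ∁ A)
  ∖-measurable mA mB = measurable-≐
    ( (λ ¬[¬b⊎a] → stable (λ ¬b → ¬[¬b⊎a] (inj₁ ¬b)) , λ a → ¬[¬b⊎a] (inj₂ a))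
    , (λ (b , ¬a) → [ (λ ¬b → ¬b b) , ¬a ]′))
    (∁-measurable (∪-measurable (∁-measurable mB) mA))

  prob-mono : ∀ {A B} → Measurable space A → Measurable space B → A ⊆ B → prob A ≤ prob B
  prob-mono {A} {B} mA mB A⊆B = 0≤e⇒x≤x+e (nonNeg m∖) (trans
    (prob-resp mB ((λ b → [ inj₁ , (λ ¬a → inj₂ (b , ¬a)) ]′ (toSum em₀)) , [ A⊆B , proj₁ ]′))
    (prob-disjoint-∪ mA m∖ λ _ a (_ , ¬a) → ¬a a))
    where m∖ = ∖-measurable mA mB

  prob-∪-≤ : ∀ {A B} → Measurable space A → Measurable space B → prob (A ∪ B) ≤ prob A + prob B
  prob-∪-≤ {A} {B} mA mB = subst (_≤ prob A + prob B)
    (trans (sym (prob-disjoint-∪ mA m∖ λ _ a (_ , ¬a) → ¬a a))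
      (prob-resp (∪-measurable mA m∖)
        ([ inj₁ , (λ (b , _) → inj₂ b) ]′ , [ inj₁ , (λ b → [ inj₁ , (λ ¬a → inj₂ (b , ¬a)) ]′ (toSum em₀)) ]′)))
    (+-mono-≤ ≤-refl (prob-mono m∖ mB proj₁))
    where m∖ = ∖-measurable mA mB

  -- Measurability is carried along because the induction step needs it in order to apply
  -- `prob-∪-≤`.
  union-bound : ∀ {b} n (B : Fin n → Pred Ω 0ℓ) → (∀ i → Measurable space (B i)) → (∀ i → prob (B i) ≤ b) →
    Measurable space (⋃ (Fin n) B) × prob (⋃ (Fin n) B) ≤ fromℕ n * b
  union-bound {b} zero B mB B≤b =
    measurable-≐ ∅≐⋃ ∅-measurable , ≤-reflexive (trans (sym (prob-resp ∅-measurable ∅≐⋃))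
      (trans prob-∅ (solve 1 (λ b → con (+ 0) := con (+ 0) :* b) refl b)))
    where
    ∅≐⋃ : ∁ U ≐ ⋃ (Fin zero) B
    ∅≐⋃ = (λ ¬tt → contradiction tt ¬tt) , λ ()
  union-bound {b} (suc n) B mB B≤b
    with m , ≤nb ← union-bound n (λ i → B (Fin.suc i)) (λ i → mB (Fin.suc i)) (λ i → B≤b (Fin.suc i)) =
    measurable-≐ split (∪-measurable (mB Fin.zero) m) ,
    subst₂ _≤_ (prob-resp (∪-measurable (mB Fin.zero) m) split)
      (solve 2 (λ n b → b :+ n :* b := (con (+ 1) :+ n) :* b) refl (fromℕ n) b)
      (≤-trans (prob-∪-≤ (mB Fin.zero) m) (+-mono-≤ (B≤b Fin.zero) ≤nb))
    where
    split : (B Fin.zero ∪ ⋃ (Fin n) (λ i → B (Fin.suc i))) ≐ ⋃ (Fin (suc n)) B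
    split = [ (λ b → Fin.zero , b) , (λ (i , b) → Fin.suc i , b) ]′
          , (λ { (Fin.zero , b) → inj₁ b ; (Fin.suc i , b) → inj₂ (i , b) })

-- The two indistinguishable adversaries.

module LowerBound (em : ExcludedMiddle (lsuc 0ℓ)) (𝓡 : CompleteOrderedField) where
  open Classical em
  open Regression 𝓡
  open RealField 𝓡
  open Chebyshev 𝓡
  open BorelSets em 𝓡

  private
    :1 : ∀ {n} → Polynomial n
    :1 = con (+ 1)

  -- By contraposition. The relation `‖_‖∞>_` asks for an actual supremum: it is `∞` if the values
  -- are unbounded and comes from completeness otherwise.
  ‖f‖≯t⇒∣fx∣≤t : ∀ {f : Interval → ℝ} {t} → ¬ (‖ f ‖∞> t) → ∀ x → ∣ f x ∣ ≤ t
  ‖f‖≯t⇒∣fx∣≤t {f} {t} ≯t x = stable λ ∣fx∣≰t → ≯t (exceeds ∣fx∣≰t)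
    where
    Values : Pred ℝ 0ℓ
    Values y = ∃[ x ] y ≡ ∣ f x ∣
    exceeds : ¬ ∣ f x ∣ ≤ t → ‖ f ‖∞> t
    exceeds ∣fx∣≰t with em₀ {∃[ b ] UpperBound Values b}
    ... | no  unbounded = ∞ , unbounded , <-∞
    ... | yes bounded with b , upper , least ← complete Values (_ , x , refl) bounded =
      fin b , (upper , least) , <-fin (≰⇒> λ b≤t → ∣fx∣≰t (≤-trans (upper _ (x , refl)) b≤t))

  centres-close : ∀ {h a b r} → ∣ h - a ∣ ≤ r → ∣ h - b ∣ ≤ r → a - b ≤ r + r
  centres-close {h} {a} {b} {r} h≈a h≈b = subst (_≤ r + r)
    (solve 3 (λ h a b → :- (h :- a) :+ (h :- b) := a :- b) refl h a b)
    (+-mono-≤ (≤-trans (-x≤∣x∣ _) h≈a) (≤-trans (x≤∣x∣ _) h≈b))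

  ∣x-x∣≤1 : ∀ x → ∣ x - x ∣ ≤ 1#
  ∣x-x∣≤1 x = ∣x∣≤b (≤-trans (≤-reflexive (-‿inverseʳ x)) 0≤1)
    (≤-trans (≤-reflexive (trans (cong -_ (-‿inverseʳ x)) -0#≈0#)) 0≤1)

  module _ (d : ℕ) (δ : ℝ) where

    -- The answers given when the truth is q: 0 up to the cut at 1 - δ and exact beyond it.
    -- Exactness in the tail keeps the answers legal for every sample, even where q exceeds 1.
    truncatedT : ℝ → ℝ
    truncatedT x with em₀ {x ≤ 1# - δ}
    ... | yes _ = 0#
    ... | no  _ = T d (x + δ)

    truncatedT≡0 : ∀ {x} → x ≤ 1# - δ → truncatedT x ≡ 0#
    truncatedT≡0 {x} x≤c with em₀ {x ≤ 1# - δ}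
    ... | yes _  = refl
    ... | no x≰c = contradiction x≤c x≰c

    x≤1-δ⇒x+δ≤1 : ∀ {x} → x ≤ 1# - δ → x + δ ≤ 1#
    x≤1-δ⇒x+δ≤1 {x} x≤c = 0≤e⇒x≤x+e (x≤y⇒0≤y-x x≤c)
      (solve 2 (λ x δ → con (+ 1) := x :+ δ :+ (con (+ 1) :- δ :- x)) refl x δ)

    x≰1-δ⇒1≤x+δ : ∀ {x} → ¬ x ≤ 1# - δ → 1# ≤ x + δ
    x≰1-δ⇒1≤x+δ {x} x≰c = 0≤e⇒x≤x+e (x≤y⇒0≤y-x (proj₁ (≰⇒> x≰c)))
      (solve 2 (λ x δ → x :+ δ := con (+ 1) :+ (x :- (con (+ 1) :- δ))) refl x δ)

    -- Beyond the cut the argument of T is at least 1, where T is nonnegative and monotone, so the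
    -- jump at the cut goes upwards.
    truncatedT-mono : ∀ {x y} → x ≤ y → truncatedT x ≤ truncatedT y
    truncatedT-mono {x} {y} x≤y with em₀ {x ≤ 1# - δ} | em₀ {y ≤ 1# - δ}
    ... | yes _   | yes _   = ≤-refl
    ... | yes _   | no y≰c  = 0≤T d (x≰1-δ⇒1≤x+δ y≰c)
    ... | no x≰c  | yes y≤c = contradiction (≤-trans x≤y y≤c) x≰c
    ... | no x≰c  | no _    = T-mono d (x≰1-δ⇒1≤x+δ x≰c) (+-monoˡ-≤ x y δ x≤y)

    -- Up to the cut, -1 ≤ x ≤ x + δ ≤ 1, so `∣T∣≤1` bounds the error.
    ∣truncatedT-q∣≤1 : 0# ≤ δ → ∀ {x} → [-1,1] x → ∣ truncatedT x - ⟦ shiftedT δ d ⟧ x ∣ ≤ 1#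
    ∣truncatedT-q∣≤1 0≤δ {x} (-1≤x , _)
      rewrite ⟦shiftedT⟧ δ d x with em₀ {x ≤ 1# - δ}
    ... | no _    = ∣x-x∣≤1 _
    ... | yes x≤c = ∣x∣≤b
      (≤-trans (≤-reflexive (+-identityˡ _)) (≤-trans (-x≤∣x∣ _) ∣T∣≤1′))
      (≤-trans (≤-reflexive (solve 1 (λ a → :- (con (+ 0) :- a) := a) refl (T d (x + δ)))) (≤-trans (x≤∣x∣ _) ∣T∣≤1′))
      where
      ∣T∣≤1′ : ∣ T d (x + δ) ∣ ≤ 1#
      ∣T∣≤1′ = ∣T∣≤1 d (≤-trans -1≤x (0≤e⇒x≤x+e 0≤δ refl)) (x≤1-δ⇒x+δ≤1 x≤c)

  map≡replicate : ∀ {n} {g : ℝ → ℝ} {c} (xs : Vec ℝ n) → (∀ i → g (lookup xs i) ≡ c) → map g xs ≡ replicate n c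
  map≡replicate []       g≡c = refl
  map≡replicate (x ∷ xs) g≡c = cong₂ _∷_ (g≡c Fin.zero) (map≡replicate xs λ i → g≡c (Fin.suc i))

  module _ {n : ℕ} (𝓔 : Experiment n) where
    open Experiment 𝓔 hiding (total)
    open Probability em 𝓡 probabilitySpace

    -- Phrased as a negation so that it is the complement of the preimage of a Borel generator.
    in-tail : ℝ → Fin n → Pred Ω 0ℓ
    in-tail δ i ω = ¬ point i ω ≤ 1# - δ

    in-tail-measurable : ∀ δ i → Measurable space (in-tail δ i)
    in-tail-measurable δ i = MeasurableSpace.∁-measurable space
      (points-measurable (generator (i , (_ , generator (lift (1# - δ))))))

    point∈[-1,1] : ∀ i ω → [-1,1] (point i ω)
    point∈[-1,1] i ω = All.lookup (points∈[-1,1] ω) (∈-lookup i (points ω))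

    -- `uniform` speaks of closed intervals, so the complement [-1, 1 - δ] is measured; δ ≤ 2 places
    -- its right end in [-1,1].
    prob-in-tail : ∀ {δ} → 0# ≤ δ → δ ≤ 1# + 1# → ∀ i → prob (in-tail δ i) ≡ δ / fromℕ 2
    prob-in-tail {δ} 0≤δ δ≤2 i = begin
      prob (in-tail δ i)                  ≡⟨ prob-∁ m ⟩
      1# - prob A                         ≡⟨ cong (λ z → 1# - z) (prob-resp m ((λ {ω} x≤c → proj₁ (point∈[-1,1] i ω) , x≤c) , proj₂)) ⟩
      1# - prob (λ ω → - 1# ≤ point i ω × point i ω ≤ 1# - δ)
        ≡⟨ cong (λ z → 1# - z) (uniform i (- 1#) (1# - δ) ≤-refl
             (0≤e⇒x≤x+e (x≤y⇒0≤y-x δ≤2) (solve 1 (λ δ → :1 :- δ := :- :1 :+ (:1 :+ :1 :- δ)) refl δ))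
             (0≤e⇒x≤x+e 0≤δ (solve 1 (λ δ → :1 := :1 :- δ :+ δ) refl δ))) ⟩
      1# - (1# - δ - - 1#) / fromℕ 2      ≡⟨ cong (_- (1# - δ - - 1#) / fromℕ 2) (sym 2/2≡1) ⟩
      fromℕ 2 / fromℕ 2 - (1# - δ - - 1#) / fromℕ 2
        ≡⟨ solve 2 (λ δ h → (:1 :+ (:1 :+ con (+ 0))) :* h :- (:1 :- δ :- :- :1) :* h := δ :* h) refl δ (fromℕ 2 ⁻¹) ⟩
      δ / fromℕ 2                         ∎
      where
      open ≡-Reasoning
      A : Pred Ω 0ℓ
      A ω = point i ω ≤ 1# - δ
      m : Measurable space A
      m = points-measurable (generator (i , (_ , generator (lift (1# - δ)))))
      2/2≡1 : fromℕ 2 / fromℕ 2 ≡ 1#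
      2/2≡1 = *-inverse-pos (0<1+x (0≤fromℕ 1))

    module _ (alg : Algorithm 𝓔) {d : ℕ} {δ C : ℝ} (0≤δ : 0# ≤ δ) (δ≤2 : δ ≤ 1# + 1#) where

      q zeroPoly : Poly≤ d
      q        = shiftedT δ d
      zeroPoly = replicate (suc d) 0#

      q-adversary : Adversary 𝓔 q 1#
      q-adversary = record
        { values     = λ _ → map (truncatedT d δ)
        ; measurable = map-measurable {advSeed} (monotone-measurable (truncatedT-mono d δ))
        ; bounded    = λ _ xs xs∈ i → subst (λ y → ∣ y - ⟦ q ⟧ (lookup xs i) ∣ ≤ 1#) (sym (lookup-map i _ xs))
                         (∣truncatedT-q∣≤1 d δ 0≤δ (All.lookup xs∈ (∈-lookup i xs)))
        }

      zero-adversary : Adversary 𝓔 zeroPoly 1#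
      zero-adversary = record
        { values     = λ _ _ → replicate n 0#
        ; measurable = constant-measurable (advSeed ⊗ Power Borel n) (Power Borel n) (replicate n 0#)
        ; bounded    = λ _ xs _ i → subst₂ (λ y z → ∣ y - z ∣ ≤ 1#)
                         (sym (lookup-replicate i 0#)) (sym (horner-0 (suc d) (lookup xs i)))
                         (∣x-x∣≤1 0#)
        }

      -- Without a point in the tail both adversaries answer 0, so a single
      -- estimate would have to be within C of both q 1 and 0.
      failure-or-in-tail : C + C < ⟦ q ⟧ 1# → ∀ ω →
        (Failure 𝓔 C alg q-adversary ω ⊎ Failure 𝓔 C alg zero-adversary ω) ⊎ ∃[ i ] in-tail δ i ω
      failure-or-in-tail 2C<q1 ω = stable λ none →
        let no-tail : ∀ i → point i ω ≤ 1# - δ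
            no-tail i = stable λ x≰c → none (inj₂ (i , x≰c))
            near-q = ‖f‖≯t⇒∣fx∣≤t (λ F → none (inj₁ (inj₁ F))) one
            near-0 = ‖f‖≯t⇒∣fx∣≤t (λ F → none (inj₁ (inj₂ F))) one
            same : map (truncatedT d δ) (points ω) ≡ replicate n 0#
            same = map≡replicate (points ω) λ i → truncatedT≡0 d δ (no-tail i)
            near-q′ : ∣ h - ⟦ q ⟧ 1# ∣ ≤ C * 1#
            near-q′ = subst (λ ys → ∣ alg 1# (algCoins ω) (zip (points ω) ys) one - ⟦ q ⟧ 1# ∣ ≤ C * 1#) same near-q
            q1-0≤2C = centres-close near-q′ near-0
        in <⇒≱ 2C<q1 (subst₂ _≤_
             (trans (cong (λ z → ⟦ q ⟧ 1# - z) (horner-0 (suc d) 1#)) (trans (cong (λ z → ⟦ q ⟧ 1# + z) -0#≈0#) (+-identityʳ _)))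
             (cong₂ _+_ (*-identityʳ C) (*-identityʳ C)) q1-0≤2C)
        where
        one : Interval
        one = 1# , 0≤e⇒x≤x+e (0≤1 ⊕ 0≤1) (solve 0 (con (+ 1) := :- con (+ 1) :+ (con (+ 1) :+ con (+ 1))) refl) , ≤-refl
        h : ℝ
        h = alg 1# (algCoins ω) (zip (points ω) (replicate n 0#)) one

      -- If the estimator survives against q, its failure event there has a measurable cover of
      -- probability at most 1/4. A cover of the other failure event that was equally small would
      -- then, with the tail event, leave total probability at most 3/4.
      one-fails : C + C < ⟦ q ⟧ 1# → fromℕ n * (δ / fromℕ 2) ≤ 1# / fromℕ 4 →
        Σ[ p ∈ Poly≤ d ] Σ[ σ ∈ ℝ ] (0# < σ ×
          Σ[ adv ∈ Adversary 𝓔 p σ ] (Pr[ Failure 𝓔 C alg adv ]> (1# / fromℕ 4)))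
      one-fails 2C<q1 tail≤¼ with em {Pr[ Failure 𝓔 C alg q-adversary ]> (1# / fromℕ 4)}
      ... | yes q-fails = q , 1# , (0≤1 , 0≢1) , q-adversary , q-fails
      ... | no ¬q-fails = zeroPoly , 1# , (0≤1 , 0≢1) , zero-adversary , λ mS₀ F₀⊆S₀ → stable λ S₀≯¼ →
        -- The small cover for q is obtained under a double negation, as the goal here is absurdity.
        ¬q-fails λ mS F⊆S → stable λ S≯¼ → contradict mS F⊆S S≯¼ mS₀ F₀⊆S₀ S₀≯¼
        where
        ¼ = 1# / fromℕ 4
        ≯¼ : ∀ {x} → ¬ ¼ < x → x ≤ ¼
        ≯¼ {x} x≯¼ = stable λ x≰¼ → x≯¼ (≰⇒> x≰¼)
        contradict : ∀ {S S₀} → Measurable space S → Failure 𝓔 C alg q-adversary ⊆ S → ¬ ¼ < prob S →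
          Measurable space S₀ → Failure 𝓔 C alg zero-adversary ⊆ S₀ → ¬ ¼ < prob S₀ → ⊥
        contradict {S} {S₀} mS F⊆S S≯¼ mS₀ F₀⊆S₀ S₀≯¼ = 1≰0 (0≤e⇒x≤x+e (0≤fromℕ 4 ⊛ x≤y⇒0≤y-x 1≤¾) 0≡1+4[¾-1])
          where
          mTail = union-bound n (in-tail δ) (in-tail-measurable δ) (λ i → ≤-reflexive (prob-in-tail 0≤δ δ≤2 i))
          mS∪S₀ = ∪-measurable mS mS₀
          m∪ = ∪-measurable mS∪S₀ (proj₁ mTail)
          0≡1+4[¾-1] : 0# ≡ 1# + fromℕ 4 * (¼ + ¼ + ¼ - 1#)
          -- The solver treats the inverse of 4 as a variable, so 4 · 4⁻¹ = 1 is substituted by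
          -- hand, in the form 3 · 1 - 3 = 0.
          0≡1+4[¾-1] = trans (solve 0 (con (+ 0) := con (+ 3) :* :1 :- con (+ 3)) refl)
            (trans (cong (λ z → fromℤ (+ 3) * z - fromℤ (+ 3)) (sym (*-inverse-pos (0<1+x (0≤fromℕ 3)))))
              (solve 1 (λ i → let ¼ = :1 :* i ; 4# = :1 :+ (:1 :+ (:1 :+ (:1 :+ con (+ 0)))) in
                  con (+ 3) :* (4# :* i) :- con (+ 3) := :1 :+ 4# :* (¼ :+ ¼ :+ ¼ :- :1)) refl (fromℕ 4 ⁻¹)))
          1≤¾ : 1# ≤ ¼ + ¼ + ¼
          1≤¾ = subst (_≤ ¼ + ¼ + ¼)
            (trans (prob-resp m∪ ((λ _ → tt) ,
              λ {ω} _ → Sum.map₁ (Sum.map F⊆S F₀⊆S₀) (failure-or-in-tail 2C<q1 ω))) (ProbabilitySpace.total probabilitySpace))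
            (≤-trans (prob-∪-≤ mS∪S₀ (proj₁ mTail)) (+-mono-≤
              (≤-trans (prob-∪-≤ mS mS₀) (+-mono-≤ (≯¼ S≯¼) (≯¼ S₀≯¼)))
              (≤-trans (proj₂ mTail) tail≤¼)))

  -- Choice of the tail width and of the threshold for d.

  1≤x⇒0<x : ∀ {x} → 1# ≤ x → 0# < x
  1≤x⇒0<x 1≤x = ≰⇒> λ x≤0 → 1≰0 (≤-trans 1≤x x≤0)

  0<x⁻¹ : ∀ {x} → 0# < x → 0# < x ⁻¹
  0<x⁻¹ {x} 0<x = 0≤x⁻¹ 0<x , λ 0≡i → 0≢1 (trans (sym (zeroʳ x)) (trans (cong (x *_) 0≡i) (*-inverse-pos 0<x)))

  module _ {C : ℝ} (1≤C : 1# ≤ C) where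

    0≤C : 0# ≤ C
    0≤C = ≤-trans 0≤1 1≤C

    0<4C : 0# < fromℕ 4 * C
    0<4C = 1≤x⇒0<x (≤-trans 1≤C (0≤e⇒x≤x+e (0≤fromℕ 3 ⊛ 0≤C)
      (solve 2 (λ C k → (:1 :+ k) :* C := C :+ k :* C) refl C (fromℕ 3))))

    module _ (d : ℕ) (C≤d : C ≤ fromℕ d) where

      d² : ℝ
      d² = fromℕ (d ^ 2)

      d²≡d*d : d² ≡ fromℕ d * fromℕ d
      d²≡d*d = trans (cong (λ k → fromℕ (d ℕ.* k)) (ℕ.*-identityʳ d)) (fromℕ-* d d)

      -- From 1 ≤ C ≤ d it follows that d ≤ d². This bound makes d² invertible and keeps the tail
      -- width at most 2.
      C≤d² : C ≤ d²
      C≤d² = subst (C ≤_) (sym d²≡d*d) (≤-trans C≤d (0≤e⇒x≤x+e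
        (0≤fromℕ d ⊛ x≤y⇒0≤y-x (≤-trans 1≤C C≤d))
        (solve 1 (λ x → x :* x := x :+ x :* (x :- :1)) refl (fromℕ d))))

      0<d² : 0# < d²
      0<d² = 1≤x⇒0<x (≤-trans 1≤C C≤d²)

      tailWidth : ℝ
      tailWidth = (C + C) / d²

      d²*tailWidth : d² * tailWidth ≡ C + C
      d²*tailWidth = trans (solve 3 (λ w c i → w :* (c :* i) := c :* (w :* i)) refl d² (C + C) (d² ⁻¹))
        (trans (cong ((C + C) *_) (*-inverse-pos 0<d²)) (*-identityʳ _))

      0≤tailWidth : 0# ≤ tailWidth
      0≤tailWidth = (0≤C ⊕ 0≤C) ⊛ 0≤x⁻¹ 0<d²

      tailWidth≤2 : tailWidth ≤ 1# + 1#
      tailWidth≤2 = *-cancelˡ-≤ 0<d² (subst₂ _≤_ (sym d²*tailWidth)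
        (solve 1 (λ w → w :+ w := w :* (:1 :+ :1)) refl d²) (+-mono-≤ C≤d² C≤d²))

      -- `T-growth` at 1 + δ gives q(1) ≥ 1 + d² δ, and d² δ is exactly 2C.
      2C<q1 : C + C < ⟦ shiftedT tailWidth d ⟧ 1#
      2C<q1 = ≰⇒> λ q1≤2C → 1≰0 (0≤e⇒x≤x+e
        (x≤y⇒0≤y-x (≤-trans (subst (1# + fromℕ d * fromℕ d * (1# + tailWidth - 1#) ≤_) (sym (⟦shiftedT⟧ tailWidth d 1#))
          (T-growth d (0≤e⇒x≤x+e 0≤tailWidth refl))) q1≤2C))
        (trans (solve 1 (λ c → con (+ 0) := :1 :+ (c :- (:1 :+ c))) refl (C + C))
          (cong (λ z → 1# + (C + C - (1# + z))) (trans (sym d²*tailWidth) (trans (cong (_* tailWidth) d²≡d*d)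
            (solve 2 (λ x δ → x :* x :* δ := x :* x :* (:1 :+ δ :- :1)) refl (fromℕ d) tailWidth))))))

      -- With ε = 1/(4C) the bound is ε d² · (2C/d²) / 2 = ε C = 1/4.
      tail≤¼ : ∀ n → fromℕ n ≤ (fromℕ 4 * C) ⁻¹ * d² → fromℕ n * (tailWidth / fromℕ 2) ≤ 1# / fromℕ 4
      tail≤¼ n n≤εd² = *-cancelˡ-≤ 0<4 (0≤e⇒x≤x+e
        (0≤fromℕ 4 ⊛ x≤y⇒0≤y-x n≤εd² ⊛ (0≤tailWidth ⊛ 0≤x⁻¹ 0<2)) (begin
          fromℕ 4 * (1# / fromℕ 4)
            ≡⟨ cong (fromℕ 4 *_) (*-identityˡ _) ⟩
          fromℕ 4 * fromℕ 4 ⁻¹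
            -- 1 is rewritten as (4C · ε) · (2 · 2⁻¹) to bring in the factors of the target.
            ≡⟨ trans (*-inverse-pos 0<4) (sym (trans (cong₂ _*_ (*-inverse-pos 0<4C) (*-inverse-pos 0<2)) (*-identityˡ 1#))) ⟩
          fromℕ 4 * C * ε * (fromℕ 2 * fromℕ 2 ⁻¹)
            ≡⟨ solve 4 (λ k C ε h → k :* C :* ε :* ((:1 :+ (:1 :+ con (+ 0))) :* h) := k :* ε :* (C :+ C) :* h)
                 refl (fromℕ 4) C ε (fromℕ 2 ⁻¹) ⟩
          fromℕ 4 * ε * (C + C) * fromℕ 2 ⁻¹
            ≡⟨ cong (λ c → fromℕ 4 * ε * c * fromℕ 2 ⁻¹) (sym d²*tailWidth) ⟩
          fromℕ 4 * ε * (d² * tailWidth) * fromℕ 2 ⁻¹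
            ≡⟨ solve 6 (λ k ε w δ h n → k :* ε :* (w :* δ) :* h := k :* (n :* (δ :* h)) :+ k :* (ε :* w :- n) :* (δ :* h))
                 refl (fromℕ 4) ε d² tailWidth (fromℕ 2 ⁻¹) (fromℕ n) ⟩
          fromℕ 4 * (fromℕ n * (tailWidth / fromℕ 2)) + fromℕ 4 * (ε * d² - fromℕ n) * (tailWidth / fromℕ 2) ∎))
        where
        open ≡-Reasoning
        ε = (fromℕ 4 * C) ⁻¹
        0<2 : 0# < fromℕ 2
        0<2 = 0<1+x (0≤fromℕ 1)
        0<4 : 0# < fromℕ 4
        0<4 = 0<1+x (0≤fromℕ 3)

lemma5p1 : ExcludedMiddle (lsuc 0ℓ) →
    (𝓡 : CompleteOrderedField) →
    let open Regression 𝓡 in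
    (C : ℝ) → 1# ≤ C →
    (s : ℕ → ℕ) → s ∈o (λ d → d ^ 2) →
    ∃[ D ] ((d : ℕ) → D ≤ℕ d →
    (𝓔 : Experiment (s d)) (alg : Algorithm 𝓔) →
    let open Experiment 𝓔 in
    Σ[ p ∈ Poly≤ d ] Σ[ σ ∈ ℝ ] (0# < σ ×
    Σ[ adv ∈ Adversary 𝓔 p σ ] (Pr[ Failure 𝓔 C alg adv ]> (1# / fromℕ 4))))
-- From `N` on, s(d) ≤ d²/(4C); `M` is a natural number that is at least C, which yields C ≤ d.
lemma5p1 em 𝓡 C 1≤C s s∈o[d²] = N ℕ.⊔ M , λ d D≤d 𝓔 alg →
  let C≤d = ≤-trans C≤M (fromℕ-mono-≤ (ℕ.≤-trans (ℕ.m≤n⊔m N M) D≤d))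
  in one-fails 𝓔 alg (0≤tailWidth 1≤C d C≤d) (tailWidth≤2 1≤C d C≤d) (2C<q1 1≤C d C≤d)
       (tail≤¼ 1≤C d C≤d (s d) (s≤εd² d (ℕ.≤-trans (ℕ.m≤m⊔n N M) D≤d)))
  where
  open Regression 𝓡
  open RealField 𝓡
  open LowerBound em 𝓡
  N,s≤εd² = s∈o[d²] ((fromℕ 4 * C) ⁻¹) (0<x⁻¹ (0<4C 1≤C))
  N = proj₁ N,s≤εd²
  s≤εd² = proj₂ N,s≤εd²
  M,C≤M = BorelSets.archimedean em 𝓡 C
  M = proj₁ M,C≤M
  C≤M = proj₂ M,C≤M
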